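{- Let $p\ge 2$ be an integer and let $r_0=r_0(p)$ be the smallest integer $r_0\ge 2$ such that $$\min_{r\ge 2}\{F_v(2_r,p;r+p-1)-r\} = F_v(2_{r_0},p;r_0+p-1)-r_0.$$ Then: (a) $F_v(2_r,p;r+p-1) = F_v(2_{r_0},p;r_0+p-1)+r-r_0$ for all $r\ge r_0$; (b) if $r_0=2$, then $F_v(2_r,p;r+p-1)=F_v(2,2,p;p+1)+r-2$ for all $r\ge 2$; (c) if $r_0>2$ and $G$ is a graph with $G \overset{v}{\rightarrow}(2_{r_0},p)$, $\omega(G)<r_0+p-1$ and $|V(G)| = F_v(2_{r_0},p;r_0+p-1)$, then $G \overset{v}{\rightarrow} (2, r_0+p-2)$; (d) $r_0 < F_v(2,2,p;p+1)-2p$; in particular $r_0(5)\le 5$.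
   Context: All graphs are finite, simple, undirected. For a graph $G$, $G \overset{v}{\rightarrow} (a_1,\dots,a_s)$ means: for every coloring of $V(G)$ with $s$ colors there is an $i$ such that $G$ contains an $a_i$-clique all of whose vertices have color $i$. $F_v(a_1,\dots,a_s;q)$ is the minimum number of vertices of a graph $G$ with $G \overset{v}{\rightarrow} (a_1,\dots,a_s)$ and clique number $\omega(G)<q$. $(2_t,p)$ denotes $t$ twos followed by $p$. -}

module Defs where

open import Data.Nat using (ℕ; _≤_; _<_; _+_)
open import Data.Fin using (Fin)
open import Data.Bool using (Bool; true; false)
open import Data.List using (List; length; lookup; replicate; _++_; [_])
open import Data.Product using (Σ; ∃; _×_)
open import Relation.Binary.PropositionalEquality using (_≡_; _≢_)
open import Relation.Nullary using (¬_)
open import Function.Definitions using (Injective)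

record Graph (n : ℕ) : Set where
  field
    adj    : Fin n → Fin n → Bool
    sym    : ∀ u v → adj u v ≡ adj v u
    irrefl : ∀ v → adj v v ≡ false
open Graph public

record Clique {n : ℕ} (G : Graph n) (a : ℕ) : Set where
  field
    vert : Fin a → Fin n
    inj  : Injective _≡_ _≡_ vert
    edge : ∀ i j → i ≢ j → adj G (vert i) (vert j) ≡ true
open Clique public

CliqueNumber< : {n : ℕ} → Graph n → ℕ → Set
CliqueNumber< G q = ¬ Clique G q

Arrows : {n : ℕ} → Graph n → List ℕ → Set
Arrows {n} G as =
  (c : Fin n → Fin (length as)) →
  Σ (Fin (length as)) λ i →
  Σ (Clique G (lookup as i)) λ K → ∀ j → c (vert K j) ≡ i

IsFv : List ℕ → ℕ → ℕ → Set
IsFv as q m =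
  (Σ (Graph m) λ G → Arrows G as × CliqueNumber< G q) ×
  (∀ n (G : Graph n) → Arrows G as → CliqueNumber< G q → m ≤ n)

twosThen : ℕ → ℕ → List ℕ
twosThen r p = replicate r 2 ++ [ p ]

module Submission where

-- Adding a cone vertex to a graph raises r and the clique number by one, so F_v(2_r,p;r+p-1) - r
-- is non-increasing in r; this is (a) and (b).  For (c), deleting the independent class V₁ leaves
-- a graph that arrows (2_{r₀-1},p); if it had no (r₀+p-2)-clique, then by the choice of r₀ it
-- would have at least |V(G)| vertices, so V₁ would be empty.
--
-- For (d), suppose that ω(G) ≤ a and that every vertex is avoided by an a-clique, and let S be an
-- a-clique.  As in Hall's theorem, S can be matched by non-edges into its complement, for a
-- Hall violator would produce a clique of size a + 1.  Hence χ(G) ≤ |V(G)| - a, while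
-- G → (2_r,p) requires r + p colours.  If r₀ > 2, then (c) allows a = r₀ + p - 2 for the minimal
-- G; if r₀ = 2, the argument is applied with a = p after deletion of two non-adjacent vertices.
-- The bound r₀(5) ≤ 5 needs in addition F_v(2,2,5;6) ≤ 16, shown by an explicit graph.

open import Defs
open import Data.Bool using (Bool; true; false; T; T?; not; _∧_; _∨_)
open import Data.Bool.ListAction using (any; all)
open import Data.Bool.Properties using (T-≡; T-∧; T-∨) renaming (_≟_ to _≟ᵇ_)
open import Data.Fin
  using (Fin; zero; suc; toℕ; fromℕ<; inject≤; punchIn; punchOut; splitAt; join; remQuot; combine)
open import Data.Fin.Properties
  using (_≟_; any?; all?; toℕ<n; toℕ-injective; fromℕ<-injective; injective⇒≤; inject≤-injective;
         punchInᵢ≢i; punchIn-injective; punchIn-punchOut; splitAt-join; join-splitAt)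
  renaming (suc-injective to sucᶠ-injective)
open import Data.List as List
  using (List; []; _∷_; _++_; length; lookup; filter; allFin; upTo; concatMap)
open import Data.List.Membership.Propositional using (_∈_)
open import Data.List.Membership.Propositional.Properties using (∈-allFin; ∈-filter⁺)
open import Data.List.Relation.Unary.All as All using (All; []; _∷_)
open import Data.List.Relation.Unary.All.Properties using (all⁺)
open import Data.List.Relation.Unary.Any as Any using (Any)
open import Data.List.Relation.Unary.Any.Properties using (any⁺; any⁻)
open import Data.Nat using (ℕ; zero; suc; _≤_; _<_; _+_; _*_; _∸_; _≡ᵇ_; z≤n; s≤s)
open import Data.Nat.DivMod using (_mod_; _%_)
import Data.Nat.Properties as ℕ
open import Data.Nat.Tactic.RingSolver using (solve-∀)
open import Data.Product using (Σ; ∃; ∃₂; _×_; _,_; proj₁; proj₂)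
open import Data.Sum using (_⊎_; inj₁; inj₂; [_,_]′)
open import Data.Vec as Vec using (Vec; []; _∷_)
open import Data.Vec.Functional using (insertAt)
open import Data.Vec.Functional.Properties using (insertAt-lookup; insertAt-punchIn)
open import Data.Vec.Properties using (lookup∘tabulate)
open import Function using (_∘_; Equivalence)
open import Function.Definitions using (Injective)
open import Relation.Binary.PropositionalEquality using (_≡_; _≢_; refl; trans; cong; subst)
  renaming (sym to ≡-sym)
open import Relation.Nullary using (¬_; Dec; yes; no; contradiction)
open import Relation.Nullary.Decidable
  using (_×-dec_; _⊎-dec_; _→-dec_; ¬?; decidable-stable; from-yes; does)

-- Injections and matchings

copair-injective : ∀ {a b n} (f : Fin a → Fin n) (g : Fin b → Fin n) →
  Injective _≡_ _≡_ f → Injective _≡_ _≡_ g → (∀ i j → f i ≢ g j) →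
  Injective _≡_ _≡_ ([ f , g ]′ ∘ splitAt a)
copair-injective {a} {b} f g f-inj g-inj f≢g {x} {y} eq =
  trans (≡-sym (join-splitAt a b x))
    (trans (cong (join a b) (on-⊎ (splitAt a x) (splitAt a y) eq)) (join-splitAt a b y))
  where
  on-⊎ : ∀ x y → [ f , g ]′ x ≡ [ f , g ]′ y → x ≡ y
  on-⊎ (inj₁ i) (inj₁ j) eq = cong inj₁ (f-inj eq)
  on-⊎ (inj₁ i) (inj₂ j) eq = contradiction eq (f≢g i j)
  on-⊎ (inj₂ i) (inj₁ j) eq = contradiction (≡-sym eq) (f≢g j i)
  on-⊎ (inj₂ i) (inj₂ j) eq = cong inj₂ (g-inj eq)

-- A decidable vertex set given as an injection from `Fin size`, so that `pullback` along `elem` is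
-- an induced subgraph and `injective⇒≤` bounds its order.
record Enumeration {n : ℕ} (P : Fin n → Set) : Set where
  field
    size      : ℕ
    elem      : Fin size → Fin n
    injective : Injective _≡_ _≡_ elem
    sound     : ∀ i → P (elem i)
    complete  : ∀ v → P v → ∃ λ i → elem i ≡ v
open Enumeration

enumerate : ∀ {n} {P : Fin n → Set} → (∀ v → Dec (P v)) → Enumeration P
enumerate {zero}  P? = record
  { size = 0 ; elem = λ () ; injective = λ {} ; sound = λ () ; complete = λ () }
enumerate {suc n} {P} P? with enumerate (P? ∘ suc) | P? zero
... | E | no ¬p0 = record
  { size      = size E
  ; elem      = suc ∘ elem E
  ; injective = injective E ∘ sucᶠ-injective
  ; sound     = sound E
  ; complete  = λ { zero p0 → contradiction p0 ¬p0
                  ; (suc v) pv → let i , eq = complete E v pv in i , cong suc eq }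
  }
... | E | yes p0 = record
  { size      = suc (size E)
  ; elem      = λ { zero → zero ; (suc i) → suc (elem E i) }
  ; injective = λ { {zero} {zero} eq → refl
                  ; {suc i} {suc j} eq → cong suc (injective E (sucᶠ-injective eq)) }
  ; sound     = λ { zero → p0 ; (suc i) → sound E i }
  ; complete  = λ { zero _ → zero , refl
                  ; (suc v) pv → let i , eq = complete E v pv in suc i , cong suc eq }
  }

punchIn-view : ∀ {n} (i j : Fin (suc n)) → j ≡ i ⊎ ∃ λ k → j ≡ punchIn i k
punchIn-view i j with i ≟ j
... | yes i≡j = inj₁ (≡-sym i≡j)
... | no  i≢j = inj₂ (punchOut i≢j , ≡-sym (punchIn-punchOut i≢j))

insertAt-injective : ∀ {k} {A : Set} (xs : Fin k → A) (i : Fin (suc k)) (x : A) →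
  Injective _≡_ _≡_ xs → (∀ j → xs j ≢ x) → Injective _≡_ _≡_ (insertAt xs i x)
insertAt-injective xs i x xs-inj xs≢x {j} {l} eq with punchIn-view i j | punchIn-view i l
... | inj₁ refl | inj₁ refl = refl
... | inj₁ refl | inj₂ (l′ , refl) = contradiction
  (trans (≡-sym (insertAt-punchIn xs i x l′)) (trans (≡-sym eq) (insertAt-lookup xs i x))) (xs≢x l′)
... | inj₂ (j′ , refl) | inj₁ refl = contradiction
  (trans (≡-sym (insertAt-punchIn xs i x j′)) (trans eq (insertAt-lookup xs i x))) (xs≢x j′)
... | inj₂ (j′ , refl) | inj₂ (l′ , refl) = cong (punchIn i) (xs-inj
  (trans (≡-sym (insertAt-punchIn xs i x j′)) (trans eq (insertAt-punchIn xs i x l′))))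

Matching : ∀ {k n} → (Fin k → Fin n → Set) → Set
Matching {k} {n} R = Σ (Fin k → Fin n) λ m → Injective _≡_ _≡_ m × ∀ i → R i (m i)

-- The witness that m cannot be augmented at zero: a set Y of matched indices such that all
-- R-neighbours of zero and of Y are already matched to Y.
Blocker : ∀ {k n} → (Fin (suc k) → Fin n → Set) → (Fin k → Fin n) → Set
Blocker {k} R m = Σ (Fin k → Bool) λ Y →
  (∀ t → R zero t → ∃ λ i → Y i ≡ true × m i ≡ t) ×
  (∀ j → Y j ≡ true → ∀ t → R (suc j) t → ∃ λ i → Y i ≡ true × m i ≡ t)

-- If zero is joined to the partner m i of i, contract zero and i into one index and drop m i.
augment : ∀ {k n} (R : Fin (suc k) → Fin n → Set) → (∀ i t → Dec (R i t)) →
  (m : Fin k → Fin n) → Injective _≡_ _≡_ m → (∀ i → R (suc i) (m i)) →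
  Matching R ⊎ Blocker R m
augment R R? m m-inj Rm with any? (R? zero)
... | no ¬Rt = inj₂ ((λ _ → false) , (λ t Rt → contradiction (t , Rt) ¬Rt) , λ _ ())
augment R R? m m-inj Rm | yes (t , Rt) with any? (λ i → m i ≟ t)
... | no t∉m = inj₁ (insertAt m zero t , insertAt-injective m zero t m-inj (λ j eq → t∉m (j , eq)) ,
  λ { zero → Rt ; (suc i) → Rm i })
augment {suc k} {n} R R? m m-inj Rm | yes (_ , R0mi) | yes (i , refl) =
  lift (augment R′ R′? (m ∘ punchIn i) (punchIn-injective i _ _ ∘ m-inj)
         λ j → Rm (punchIn i j) , punchInᵢ≢i i j ∘ m-inj)
  where
  R′ : Fin (suc k) → Fin n → Set
  R′ zero    t = (R zero t ⊎ R (suc i) t) × t ≢ m i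
  R′ (suc j) t = R (suc (punchIn i j)) t × t ≢ m i
  R′? : ∀ j t → Dec (R′ j t)
  R′? zero    t = (R? zero t ⊎-dec R? (suc i) t) ×-dec ¬? (t ≟ m i)
  R′? (suc j) t = R? (suc (punchIn i j)) t ×-dec ¬? (t ≟ m i)
  -- Undoes the contraction: zero gets `x` and `suc i` gets `y`, one of which is `m′ zero` and the
  -- other the dropped `m i`.
  extend : (m′ : Fin (suc k) → Fin n) → Injective _≡_ _≡_ m′ → (∀ j → R′ j (m′ j)) →
    ∀ x y → x ≢ y → (∀ j → m′ (suc j) ≢ x) → (∀ j → m′ (suc j) ≢ y) →
    R zero x → R (suc i) y → Matching R
  extend m′ inj Rm′ x y x≢y ≢x ≢y R0x Riy = insertAt rest zero x ,
    insertAt-injective rest zero x rest-inj rest≢x ,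
    λ { zero → R0x ; (suc j) → R-rest j }
    where
    rest : Fin (suc k) → Fin n
    rest = insertAt (m′ ∘ suc) i y
    rest-inj : Injective _≡_ _≡_ rest
    rest-inj = insertAt-injective (m′ ∘ suc) i y (sucᶠ-injective ∘ inj) ≢y
    rest≢x : ∀ j → rest j ≢ x
    rest≢x j eq with punchIn-view i j
    ... | inj₁ refl = x≢y (trans (≡-sym eq) (insertAt-lookup (m′ ∘ suc) i y))
    ... | inj₂ (j′ , refl) = ≢x j′ (trans (≡-sym (insertAt-punchIn (m′ ∘ suc) i y j′)) eq)
    R-rest : ∀ j → R (suc j) (rest j)
    R-rest j with punchIn-view i j
    ... | inj₁ refl = subst (R (suc i)) (≡-sym (insertAt-lookup (m′ ∘ suc) i y)) Riy
    ... | inj₂ (j′ , refl) = subst (R (suc (punchIn i j′)))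
      (≡-sym (insertAt-punchIn (m′ ∘ suc) i y j′)) (proj₁ (Rm′ (suc j′)))
  lift : Matching R′ ⊎ Blocker R′ (m ∘ punchIn i) → Matching R ⊎ Blocker R m
  lift (inj₁ (m′ , inj , Rm′)) with Rm′ zero
  ... | inj₁ R0t , t≢mi = inj₁ (extend m′ inj Rm′ (m′ zero) (m i) t≢mi
    (λ j eq → contradiction (inj eq) λ ()) (λ j → proj₂ (Rm′ (suc j))) R0t (Rm i))
  ... | inj₂ Rit , t≢mi = inj₁ (extend m′ inj Rm′ (m i) (m′ zero) (t≢mi ∘ ≡-sym)
    (λ j → proj₂ (Rm′ (suc j))) (λ j eq → contradiction (inj eq) λ ()) R0mi Rit)
  lift (inj₂ (Y′ , block0 , block)) =
    inj₂ (Y , (λ t R0t → via t (λ t≢mi → block0 t (inj₁ R0t , t≢mi))) , blockY)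
    where
    -- Adding `i` covers the dropped vertex `m i`; every other neighbour of zero or of `suc i` is a
    -- neighbour of the contracted index and is covered by `block0`.
    Y : Fin (suc k) → Bool
    Y = insertAt Y′ i true
    via : ∀ t → (t ≢ m i → ∃ λ j → Y′ j ≡ true × m (punchIn i j) ≡ t) → ∃ λ j → Y j ≡ true × m j ≡ t
    via t h with t ≟ m i
    ... | yes refl = i , insertAt-lookup Y′ i true , refl
    ... | no t≢mi = let j , Yj , eq = h t≢mi in
      punchIn i j , trans (insertAt-punchIn Y′ i true j) Yj , eq
    blockY : ∀ j → Y j ≡ true → ∀ t → R (suc j) t → ∃ λ l → Y l ≡ true × m l ≡ t
    blockY j Yj t Rjt with punchIn-view i j
    ... | inj₁ refl = via t λ t≢mi → block0 t (inj₂ Rjt , t≢mi)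
    ... | inj₂ (j′ , refl) = via t λ t≢mi →
      block j′ (trans (≡-sym (insertAt-punchIn Y′ i true j′)) Yj) t (Rjt , t≢mi)

-- Matching a maximum clique by non-edges

mkClique : ∀ {n a} (G : Graph n) (K : Fin a → Fin n) →
  (∀ i j → i ≢ j → adj G (K i) (K j) ≡ true) → Clique G a
mkClique G K K-edge = record
  { vert = K
  ; inj  = λ {i} {j} eq → decidable-stable (i ≟ j) λ i≢j →
             contradiction (trans (≡-sym (K-edge i j i≢j))
               (trans (cong (adj G (K i)) (≡-sym eq)) (irrefl G (K i)))) λ ()
  ; edge = K-edge
  }

≢false⇒≡true : ∀ {b} → b ≢ false → b ≡ true
≢false⇒≡true {false} b≢false = contradiction refl b≢false
≢false⇒≡true {true}  _       = refl

true≢false : ∀ {b} → b ≡ true → b ≢ false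
true≢false refl ()

Colouring : ∀ {n} → Graph n → ℕ → Set
Colouring {n} G k = Σ (Fin n → Fin k) λ c → ∀ u v → c u ≡ c v → adj G u v ≡ false

CliqueAvoiding : ∀ {n} → Graph n → ℕ → Fin n → Set
CliqueAvoiding G a v = Σ (Clique G a) λ K → ∀ i → vert K i ≢ v

module _ {n a : ℕ} (G : Graph n) (ω≤a : CliqueNumber< G (suc a)) (avoid : ∀ v → CliqueAvoiding G a v)
         {U : Fin n → Set} (U? : ∀ v → Dec (U v)) where

  NonEdgeInto : ∀ {k} → (Fin k → Fin n) → Fin k → Fin n → Set
  NonEdgeInto S i t = adj G (S i) t ≡ false × U t

  -- In an a-clique avoiding S zero, replace the vertices matched to Y by their partners in Y;
  -- together with S zero this would be a clique of size a + 1.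
  no-blocker : ∀ {k} (S : Fin (suc k) → Fin n) → (∀ i j → i ≢ j → adj G (S i) (S j) ≡ true) →
    (∀ t → ¬ U t → ∀ i → S i ≢ t → adj G (S i) t ≡ true) →
    (m : Fin k → Fin n) → (∀ i → NonEdgeInto S (suc i) (m i)) →
    ¬ Blocker (NonEdgeInto S) m
  no-blocker {k} S S-edge S-outside m m-nonedge (Y , block0 , block) =
    ω≤a (mkClique G vertex vertex-edge)
    where
    A = proj₁ (avoid (S zero))
    Swap : Fin n → Set
    Swap x = ∃ λ j → Y j ≡ true × m j ≡ x
    swap : ∀ x → Dec (Swap x) → Fin n
    swap x (yes (j , _)) = S (suc j)
    swap x (no _)        = x
    swap? : ∀ x → Dec (Swap x)
    swap? x = any? λ j → (Y j ≟ᵇ true) ×-dec (m j ≟ x)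
    S-kept : ∀ i x → (∀ t → NonEdgeInto S i t → Swap t) → ¬ Swap x → S i ≢ x → adj G (S i) x ≡ true
    S-kept i x blocked kept Si≢x with U? x
    ... | yes Ux = ≢false⇒≡true λ nonadj → kept (blocked x (nonadj , Ux))
    ... | no ¬Ux = S-outside x ¬Ux i Si≢x
    swapped-kept : ∀ j x y → Y j ≡ true → m j ≡ x → ¬ Swap y → adj G x y ≡ true →
      adj G (S (suc j)) y ≡ true
    -- `y` cannot be `S (suc j)` itself: `y` is adjacent to `x`, but `x` is the partner of
    -- `S (suc j)` by a non-edge.
    swapped-kept j x y Yj mj≡x kept xy = S-kept (suc j) y (block j Yj) kept λ { refl →
      true≢false xy (trans (Graph.sym G x (S (suc j)))
        (trans (cong (adj G (S (suc j))) (≡-sym mj≡x)) (proj₁ (m-nonedge j)))) }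
    S0-edge : ∀ x dx → x ≢ S zero → adj G (S zero) (swap x dx) ≡ true
    S0-edge x (yes (j , _)) _    = S-edge zero (suc j) λ ()
    S0-edge x (no kept)     x≢S0 = S-kept zero x block0 kept (x≢S0 ∘ ≡-sym)
    swap-edge : ∀ x y dx dy → x ≢ y → adj G x y ≡ true → adj G (swap x dx) (swap y dy) ≡ true
    swap-edge x y (yes (i , _ , mi≡x)) (yes (j , _ , mj≡y)) x≢y xy =
      S-edge (suc i) (suc j) λ { refl → x≢y (trans (≡-sym mi≡x) mj≡y) }
    swap-edge x y (yes (i , Yi , mi≡x)) (no y-kept) x≢y xy = swapped-kept i x y Yi mi≡x y-kept xy
    swap-edge x y (no x-kept) (yes (j , Yj , mj≡y)) x≢y xy = trans (Graph.sym G x (S (suc j)))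
      (swapped-kept j y x Yj mj≡y x-kept (trans (Graph.sym G y x) xy))
    swap-edge x y (no _) (no _) x≢y xy = xy
    vertex : Fin (suc a) → Fin n
    vertex zero    = S zero
    vertex (suc i) = swap (vert A i) (swap? (vert A i))
    vertex-edge : ∀ i j → i ≢ j → adj G (vertex i) (vertex j) ≡ true
    vertex-edge zero    zero    i≢j = contradiction refl i≢j
    vertex-edge zero    (suc j) i≢j = S0-edge (vert A j) (swap? _) (proj₂ (avoid (S zero)) j)
    vertex-edge (suc i) zero    i≢j = trans (Graph.sym G (vertex (suc i)) (S zero))
      (S0-edge (vert A i) (swap? _) (proj₂ (avoid (S zero)) i))
    vertex-edge (suc i) (suc j) i≢j = swap-edge (vert A i) (vert A j) (swap? _) (swap? _)
      (i≢j ∘ cong suc ∘ inj A) (edge A i j (i≢j ∘ cong suc))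

  -- Induction on the clique with `U` fixed. A vertex dropped from `S` must not become available as
  -- a partner, so `U` is not the complement of `S`; the premise on vertices outside `U` takes its
  -- place.
  nonedge-matching : ∀ {k} (S : Fin k → Fin n) → (∀ i j → i ≢ j → adj G (S i) (S j) ≡ true) →
    (∀ t → ¬ U t → ∀ i → S i ≢ t → adj G (S i) t ≡ true) → Matching (NonEdgeInto S)
  nonedge-matching {zero}  S S-edge S-outside = (λ ()) , (λ {}) , λ ()
  nonedge-matching {suc k} S S-edge S-outside
    with nonedge-matching (S ∘ suc) (λ i j i≢j → S-edge (suc i) (suc j) (i≢j ∘ sucᶠ-injective))
           (λ t ¬Ut i → S-outside t ¬Ut (suc i))
  ... | m , m-inj , m-nonedge
    with augment (NonEdgeInto S) (λ i t → (adj G (S i) t ≟ᵇ false) ×-dec U? t) m m-inj m-nonedge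
  ... | inj₁ m′      = m′
  ... | inj₂ blocker = contradiction blocker (no-blocker S S-edge S-outside m m-nonedge)

-- Each vertex of a maximum clique shares its colour with its partner in a matching by
-- non-edges; the remaining vertices get colours of their own.
colouring-≤ : ∀ {n a} (G : Graph n) → CliqueNumber< G (suc a) → Clique G a →
  (∀ v → CliqueAvoiding G a v) → ∃ λ k → k + a ≤ n × Colouring G k
colouring-≤ {n} {a} G ω≤a K avoid = a + size rest , bound , colour , proper
  where
  InK : Fin n → Set
  InK v = ∃ λ i → vert K i ≡ v
  InK? : ∀ v → Dec (InK v)
  InK? v = any? λ i → vert K i ≟ v
  M : Matching (NonEdgeInto G ω≤a avoid (¬? ∘ InK?) (vert K))
  M = nonedge-matching G ω≤a avoid (¬? ∘ InK?) (vert K) (edge K) λ t ¬¬InK i Ki≢t →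
    let j , Kj≡t = decidable-stable (InK? t) ¬¬InK in
    subst (λ v → adj G (vert K i) v ≡ true) Kj≡t
      (edge K i j λ i≡j → Ki≢t (trans (cong (vert K) i≡j) Kj≡t))
  m = proj₁ M
  m-nonadj : ∀ i → adj G (vert K i) (m i) ≡ false
  m-nonadj i = proj₁ (proj₂ (proj₂ M) i)
  InM : Fin n → Set
  InM v = ∃ λ i → m i ≡ v
  InM? : ∀ v → Dec (InM v)
  InM? v = any? λ i → m i ≟ v
  rest : Enumeration (λ v → ¬ InK v × ¬ InM v)
  rest = enumerate λ v → ¬? (InK? v) ×-dec ¬? (InM? v)
  -- The clique, the partners and the rest are pairwise disjoint.
  bound : a + size rest + a ≤ n
  bound = subst (_≤ n) (ℕ.+-comm a (a + size rest))
    (injective⇒≤ K⊎M⊎rest-injective)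
    where
    M⊎rest : Fin (a + size rest) → Fin n
    M⊎rest = [ m , elem rest ]′ ∘ splitAt a
    K⊎M⊎rest : Fin (a + (a + size rest)) → Fin n
    K⊎M⊎rest = [ vert K , M⊎rest ]′ ∘ splitAt a
    K⊎M⊎rest-injective : Injective _≡_ _≡_ K⊎M⊎rest
    K⊎M⊎rest-injective = copair-injective (vert K) M⊎rest (inj K)
      (copair-injective m (elem rest) (proj₁ (proj₂ M)) (injective rest)
        λ i j eq → proj₂ (sound rest j) (i , eq))
      λ i x eq → outside (splitAt a x) (i , eq)
      where
      outside : ∀ x → ¬ InK ([ m , elem rest ]′ x)
      outside (inj₁ j) = proj₂ (proj₂ (proj₂ M) j)
      outside (inj₂ j) = proj₁ (sound rest j)
  Class : Fin a ⊎ Fin (size rest) → Fin n → Set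
  Class (inj₁ i) v = vert K i ≡ v ⊎ m i ≡ v
  Class (inj₂ i) v = elem rest i ≡ v
  class : ∀ v → ∃ λ x → Class x v
  class v with InK? v | InM? v
  ... | yes (i , eq) | _            = inj₁ i , inj₁ eq
  ... | no _         | yes (i , eq) = inj₁ i , inj₂ eq
  ... | no ∉K        | no ∉M        = let i , eq = complete rest v (∉K , ∉M) in inj₂ i , eq
  class-indep : ∀ x {u v} → Class x u → Class x v → adj G u v ≡ false
  class-indep (inj₁ i) (inj₁ refl) (inj₁ refl) = irrefl G _
  class-indep (inj₁ i) (inj₁ refl) (inj₂ refl) = m-nonadj i
  class-indep (inj₁ i) (inj₂ refl) (inj₁ refl) = trans (Graph.sym G _ _) (m-nonadj i)
  class-indep (inj₁ i) (inj₂ refl) (inj₂ refl) = irrefl G _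
  class-indep (inj₂ i) refl        refl        = irrefl G _
  colour : Fin n → Fin (a + size rest)
  colour v = join a (size rest) (proj₁ (class v))
  proper : ∀ u v → colour u ≡ colour v → adj G u v ≡ false
  proper u v eq = class-indep (proj₁ (class u)) (proj₂ (class u))
    (subst (λ x → Class x v) (≡-sym same) (proj₂ (class v)))
    where
    same : proj₁ (class u) ≡ proj₁ (class v)
    same = trans (≡-sym (splitAt-join a _ _)) (trans (cong (splitAt a) eq) (splitAt-join a _ _))

-- Vertex arrowing with ℕ-valued colourings

pullback : ∀ {m n} → Graph n → (Fin m → Fin n) → Graph m
pullback G e = record
  { adj    = λ i j → adj G (e i) (e j)
  ; sym    = λ i j → Graph.sym G (e i) (e j)
  ; irrefl = λ i → irrefl G (e i)
  }

pullback-clique : ∀ {m n a} (G : Graph n) (e : Fin m → Fin n) → Clique (pullback G e) a → Clique G a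
pullback-clique G e K = mkClique G (e ∘ vert K) (edge K)

-- Colours 0, …, r - 1 play the role of the r twos, and all colours ≥ r that of p.
Forced : ∀ {n} → Graph n → ℕ → ℕ → (Fin n → ℕ) → Set
Forced {n} G r p c =
  (∃₂ λ u v → adj G u v ≡ true × c u ≡ c v × c u < r) ⊎
  (Σ (Clique G p) λ K → ∀ j → r ≤ c (vert K j))

Forces : ∀ {n} → Graph n → ℕ → ℕ → Set
Forces {n} G r p = (c : Fin n → ℕ) → Forced G r p c

-- Turns ℕ-valued colourings into those of `Arrows` by merging all colours from `r` on.
clamp : ∀ r p → ℕ → Fin (length (twosThen r p))
clamp zero    p _       = zero
clamp (suc r) p zero    = zero
clamp (suc r) p (suc x) = suc (clamp r p x)

-- For variable `r` the list does not compute, so its positions are sorted here into the twos, each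
-- hit by one number only, and the final `p`.
colour-view : ∀ r p (i : Fin (length (twosThen r p))) →
  (lookup (twosThen r p) i ≡ 2 × toℕ i < r × (∀ x → clamp r p x ≡ i → x ≡ toℕ i)) ⊎
  (lookup (twosThen r p) i ≡ p × toℕ i ≡ r × (∀ x → clamp r p x ≡ i → r ≤ x))
colour-view zero    p zero = inj₂ (refl , refl , λ _ _ → z≤n)
colour-view (suc r) p zero = inj₁ (refl , s≤s z≤n , λ { zero _ → refl ; (suc x) () })
colour-view (suc r) p (suc i) with colour-view r p i
... | inj₁ (is2 , i<r , at) = inj₁ (is2 , s≤s i<r ,
  λ { zero () ; (suc x) eq → cong suc (at x (sucᶠ-injective eq)) })
... | inj₂ (isp , i≡r , at) = inj₂ (isp , cong suc i≡r ,
  λ { zero () ; (suc x) eq → s≤s (at x (sucᶠ-injective eq)) })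

arrows⇒forces : ∀ {n} (G : Graph n) r p → Arrows G (twosThen r p) → Forces G r p
arrows⇒forces G r p arrows c with arrows (clamp r p ∘ c)
... | i , K , K-colour with colour-view r p i
... | inj₁ (is2 , i<r , at) = inj₁ (pair is2 K λ j → at _ (K-colour j))
  where
  pair : ∀ {a} → a ≡ 2 → (K : Clique G a) → (∀ j → c (vert K j) ≡ toℕ i) →
    ∃₂ λ u v → adj G u v ≡ true × c u ≡ c v × c u < r
  pair refl K col = vert K zero , vert K (suc zero) , edge K zero (suc zero) (λ ()) ,
    trans (col zero) (≡-sym (col (suc zero))) , subst (_< r) (≡-sym (col zero)) i<r
... | inj₂ (isp , _ , at) = inj₂ (resize isp K λ j → at _ (K-colour j))
  where
  resize : ∀ {a} → a ≡ p → (K : Clique G a) → (∀ j → r ≤ c (vert K j)) →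
    Σ (Clique G p) λ K → ∀ j → r ≤ c (vert K j)
  resize refl K col = K , col

forces⇒arrows : ∀ {n} (G : Graph n) r p → Forces G r p → Arrows G (twosThen r p)
forces⇒arrows {n} G r p forces c with forces (toℕ ∘ c)
... | inj₁ (u , v , uv , cu≡cv , cu<r) with colour-view r p (c u)
...   | inj₁ (is2 , _) = c u , pair is2
  where
  pair : ∀ {a} → a ≡ 2 → Σ (Clique G a) λ K → ∀ j → c (vert K j) ≡ c u
  pair refl = mkClique G (λ { zero → u ; (suc zero) → v })
      (λ { zero zero i≢j → contradiction refl i≢j
         ; zero (suc zero) _ → uv
         ; (suc zero) zero _ → trans (Graph.sym G v u) uv
         ; (suc zero) (suc zero) i≢j → contradiction refl i≢j }) ,
    λ { zero → refl ; (suc zero) → toℕ-injective (≡-sym cu≡cv) }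
...   | inj₂ (_ , cu≡r , _) = contradiction cu≡r (ℕ.<⇒≢ cu<r)
forces⇒arrows {n} G r p forces c | inj₂ (K , K-colour) with colour-view r p (clamp r p r)
... | inj₁ (_ , <r , at) = contradiction (≡-sym (at r refl)) (ℕ.<⇒≢ <r)
... | inj₂ (isp , last≡r , _) = clamp r p r , resize isp
  where
  K-last : ∀ j → c (vert K j) ≡ clamp r p r
  K-last j with colour-view r p (c (vert K j))
  ... | inj₁ (_ , <r , _) = contradiction (K-colour j) (ℕ.<⇒≱ <r)
  ... | inj₂ (_ , ≡r , _) = toℕ-injective (trans ≡r (≡-sym last≡r))
  resize : ∀ {a} → a ≡ p → Σ (Clique G a) λ K → ∀ j → c (vert K j) ≡ clamp r p r
  resize refl = K , K-last

-- Makes the appeal to minimality in `minimal⇒clique` constructive. The search runs over vectors,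
-- which allow recursion on the length.
clique? : ∀ {n} (G : Graph n) a {P : Fin n → Set} → (∀ v → Dec (P v)) →
  Dec (Σ (Clique G a) λ K → ∀ j → P (vert K j))
clique? {n} G a {P} P? with anyVec? a good?
  where
  Good : Vec (Fin n) a → Set
  Good xs = (∀ i j → i ≢ j → adj G (Vec.lookup xs i) (Vec.lookup xs j) ≡ true) ×
            (∀ i → P (Vec.lookup xs i))
  good? : ∀ xs → Dec (Good xs)
  good? xs = (all? λ i → all? λ j → ¬? (i ≟ j) →-dec (adj G (Vec.lookup xs i) (Vec.lookup xs j) ≟ᵇ true))
    ×-dec all? λ i → P? (Vec.lookup xs i)
  anyVec? : ∀ k {Q : Vec (Fin n) k → Set} → (∀ xs → Dec (Q xs)) → Dec (∃ Q)
  anyVec? zero Q? with Q? []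
  ... | yes q = yes ([] , q)
  ... | no ¬q = no λ { ([] , q) → ¬q q }
  anyVec? (suc k) Q? with any? (λ x → anyVec? k (λ xs → Q? (x ∷ xs)))
  ... | yes (x , xs , q) = yes (x ∷ xs , q)
  ... | no ¬q = no λ { (x ∷ xs , q) → ¬q (x , xs , q) }
... | yes (xs , xs-edge , Pxs) = yes (mkClique G (Vec.lookup xs) xs-edge , Pxs)
... | no ¬good = no λ (K , PK) → ¬good (Vec.tabulate (vert K) ,
  (λ i j i≢j → subst (λ u → adj G u _ ≡ true) (≡-sym (lookup∘tabulate (vert K) i))
                 (subst (λ v → adj G _ v ≡ true) (≡-sym (lookup∘tabulate (vert K) j)) (edge K i j i≢j))) ,
  λ i → subst P (≡-sym (lookup∘tabulate (vert K) i)) (PK i))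

-- A proper colouring has no monochromatic edge, so it forces a clique on colours from `r` on; its
-- `suc p` vertices have distinct colours between `r` and `k`.
forces⇒<colours : ∀ {n} (G : Graph n) r p k → Forces G r (suc p) → Colouring G k → r + p < k
forces⇒<colours G r p k forces (c , proper) with forces (toℕ ∘ c)
... | inj₁ (u , v , uv , cu≡cv , _) = contradiction (proper u v (toℕ-injective cu≡cv)) (true≢false uv)
... | inj₂ (K , r≤c) = subst (r + p <_) (ℕ.m+[n∸m]≡n r≤k)
    (ℕ.+-monoʳ-< r (injective⇒≤ {f = shifted} shifted-injective))
  where
  colour = toℕ ∘ c ∘ vert K
  -- The clique is non-empty, being of size `suc p`.
  r≤k : r ≤ k
  r≤k = ℕ.≤-trans (r≤c zero) (ℕ.<⇒≤ (toℕ<n _))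
  shifted : Fin (suc p) → Fin (k ∸ r)
  shifted j = fromℕ< (ℕ.∸-monoˡ-< (toℕ<n (c (vert K j))) (r≤c j))
  shifted-injective : Injective _≡_ _≡_ shifted
  shifted-injective {i} {j} eq = decidable-stable (i ≟ j) λ i≢j →
    contradiction (proper _ _ (toℕ-injective (ℕ.∸-cancelʳ-≡ (r≤c i) (r≤c j)
      (fromℕ<-injective (colour i ∸ r) (colour j ∸ r) _ _ eq)))) (true≢false (edge K i j i≢j))

-- Colour the deleted vertices 0 and shift all other colours up by one: an edge in colour 0 is
-- impossible, and the remaining outcomes lie in the subgraph.
delete-independent : ∀ {n} (G : Graph n) {r p} {P : Fin n → Set} (P? : ∀ v → Dec (P v)) (E : Enumeration P) →
  (∀ u v → ¬ P u → ¬ P v → adj G u v ≡ false) → Forces G (suc r) p → Forces (pullback G (elem E)) r p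
delete-independent {n} G {r} {p} {P} P? E indep forces c = pull (forces c′)
  where
  colour : ∀ v → Dec (P v) → ℕ
  colour v (yes Pv) = suc (c (proj₁ (complete E v Pv)))
  colour v (no _)   = 0
  c′ : Fin n → ℕ
  c′ v = colour v (P? v)
  c′-view : ∀ v → (¬ P v × c′ v ≡ 0) ⊎ ∃ λ i → elem E i ≡ v × c′ v ≡ suc (c i)
  c′-view v with P? v
  ... | yes Pv = let i , eq = complete E v Pv in inj₂ (i , eq , refl)
  ... | no ¬Pv = inj₁ (¬Pv , refl)
  index : ∀ v → suc r ≤ c′ v → ∃ λ i → elem E i ≡ v × r ≤ c i
  index v r<c′ with c′-view v
  ... | inj₁ (_ , ≡0) = contradiction (subst (suc r ≤_) ≡0 r<c′) λ ()
  ... | inj₂ (i , eq , ≡suc) = i , eq , ℕ.≤-pred (subst (suc r ≤_) ≡suc r<c′)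
  pull : Forced G (suc r) p c′ → Forced (pullback G (elem E)) r p c
  pull (inj₁ (u , v , uv , same , small)) with c′-view u | c′-view v
  ... | inj₁ (¬Pu , _)   | inj₁ (¬Pv , _)   = contradiction (indep u v ¬Pu ¬Pv) (true≢false uv)
  ... | inj₁ (_ , ≡0)    | inj₂ (_ , _ , ≡suc) = contradiction (trans (≡-sym ≡0) (trans same ≡suc)) λ ()
  ... | inj₂ (_ , _ , ≡suc) | inj₁ (_ , ≡0) = contradiction (trans (≡-sym ≡0) (trans (≡-sym same) ≡suc)) λ ()
  ... | inj₂ (i , refl , cu) | inj₂ (j , refl , cv) = inj₁ (i , j , uv ,
    ℕ.suc-injective (trans (≡-sym cu) (trans same cv)) , ℕ.≤-pred (subst (_< suc r) cu small))
  pull (inj₂ (K , K-colour)) = inj₂ (mkClique (pullback G (elem E)) (λ j → proj₁ (at j)) at-edge ,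
    λ j → proj₂ (proj₂ (at j)))
    where
    at : ∀ j → ∃ λ i → elem E i ≡ vert K j × r ≤ c i
    at j = index (vert K j) (K-colour j)
    at-edge : ∀ i j → i ≢ j → adj G (elem E (proj₁ (at i))) (elem E (proj₁ (at j))) ≡ true
    at-edge i j i≢j = trans (cong (adj G _) (proj₁ (proj₂ (at j))))
      (trans (cong (λ u → adj G u _) (proj₁ (proj₂ (at i)))) (edge K i j i≢j))

-- Adding a cone vertex

cone : ∀ {n} → Graph n → Graph (suc n)
cone {n} G = record { adj = cone-adj ; sym = cone-sym ; irrefl = cone-irrefl }
  where
  cone-adj : Fin (suc n) → Fin (suc n) → Bool
  cone-adj zero    zero    = false
  cone-adj zero    (suc _) = true
  cone-adj (suc _) zero    = true
  cone-adj (suc u) (suc v) = adj G u v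
  cone-sym : ∀ u v → cone-adj u v ≡ cone-adj v u
  cone-sym zero    zero    = refl
  cone-sym zero    (suc _) = refl
  cone-sym (suc _) zero    = refl
  cone-sym (suc u) (suc v) = Graph.sym G u v
  cone-irrefl : ∀ v → cone-adj v v ≡ false
  cone-irrefl zero    = refl
  cone-irrefl (suc v) = irrefl G v

cone-CliqueNumber< : ∀ {n} (G : Graph n) q → CliqueNumber< G q → CliqueNumber< (cone G) (suc q)
cone-CliqueNumber< {n} G q ω<q K = ω<q (mkClique G (proj₁ ∘ base) base-edge)
  where
  apex-index : ∃ λ i → ∀ j → j ≢ i → vert K j ≢ zero
  apex-index with any? (λ i → vert K i ≟ zero)
  ... | yes (i , Ki≡0) = i , λ j j≢i Kj≡0 → j≢i (inj K (trans Kj≡0 (≡-sym Ki≡0)))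
  -- The clique already lies in `G`; dropping an arbitrary index leaves `q` vertices.
  ... | no ∌0 = zero , λ j _ Kj≡0 → ∌0 (j , Kj≡0)
  i₀ = proj₁ apex-index
  lower : (x : Fin (suc n)) → x ≢ zero → ∃ λ y → suc y ≡ x
  lower zero    x≢0 = contradiction refl x≢0
  lower (suc y) _   = y , refl
  base : ∀ j → ∃ λ y → suc y ≡ vert K (punchIn i₀ j)
  base j = lower _ (proj₂ apex-index (punchIn i₀ j) (punchInᵢ≢i i₀ j))
  base-edge : ∀ i j → i ≢ j → adj (cone G) (suc (proj₁ (base i))) (suc (proj₁ (base j))) ≡ true
  base-edge i j i≢j = trans (cong (adj (cone G) (suc (proj₁ (base i)))) (proj₂ (base j)))
    (trans (cong (λ u → adj (cone G) u (vert K (punchIn i₀ j))) (proj₂ (base i)))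
      (edge K _ _ (i≢j ∘ punchIn-injective i₀ i j)))

cone-clique : ∀ {n a} (G : Graph n) → Clique G a → Clique (cone G) a
cone-clique G K = mkClique (cone G) (suc ∘ vert K) (edge K)

cone-replace : ∀ {n a} (G : Graph n) (K : Clique G a) (i : Fin a) →
  Σ (Clique (cone G) a) λ K′ → ∀ j → vert K′ j ≡ zero ⊎ (j ≢ i × vert K′ j ≡ suc (vert K j))
cone-replace {n} {a} G K i = mkClique (cone G) (λ j → vertex j (j ≟ i))
    (λ j l j≢l → vertex-edge j l j≢l (j ≟ i) (l ≟ i)) , λ j → vertex-view j (j ≟ i)
  where
  vertex : ∀ j → Dec (j ≡ i) → Fin (suc n)
  vertex j (yes _) = zero
  vertex j (no _)  = suc (vert K j)
  vertex-edge : ∀ j l → j ≢ l → ∀ dj dl → adj (cone G) (vertex j dj) (vertex l dl) ≡ true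
  vertex-edge j l j≢l (yes j≡i) (yes l≡i) = contradiction (trans j≡i (≡-sym l≡i)) j≢l
  vertex-edge j l j≢l (yes _)   (no _)    = refl
  vertex-edge j l j≢l (no _)    (yes _)   = refl
  vertex-edge j l j≢l (no _)    (no _)    = edge K j l j≢l
  vertex-view : ∀ j dj → vertex j dj ≡ zero ⊎ (j ≢ i × vertex j dj ≡ suc (vert K j))
  vertex-view j (yes _)  = inj₁ refl
  vertex-view j (no j≢i) = inj₂ (j≢i , refl)

-- Suppose first that the apex has a colour above `r`. In a clique found in `G`, two vertices of
-- colour `r` form the wanted edge, and a single one is replaced by the apex. If the apex has a
-- colour up to `r`, either this colour recurs and gives an edge at the apex, or it can replace `r`
-- in `G`.
cone-forces : ∀ {n} (G : Graph n) r p → Forces G r p → Forces (cone G) (suc r) p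
cone-forces {n} G r p forces c with c zero ℕ.<? suc r
... | no c0≮ with forces (c ∘ suc)
...   | inj₁ (u , v , uv , same , cu<r) = inj₁ (suc u , suc v , uv , same , ℕ.m<n⇒m<1+n cu<r)
...   | inj₂ (K , r≤c) with any? (λ i → c (suc (vert K i)) ℕ.≟ r)
...     | no c≢r = inj₂ (cone-clique G K , λ j → ℕ.≤∧≢⇒< (r≤c j) λ r≡c → c≢r (j , ≡-sym r≡c))
...     | yes (i , ci≡r) with any? (λ j → ¬? (j ≟ i) ×-dec (c (suc (vert K j)) ℕ.≟ r))
...       | yes (j , j≢i , cj≡r) = inj₁ (suc (vert K j) , suc (vert K i) , edge K j i j≢i ,
  trans cj≡r (≡-sym ci≡r) , subst (_< suc r) (≡-sym cj≡r) ℕ.≤-refl)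
...       | no others≢r = inj₂ (K′ , λ j → large j (K′-view j))
  where
  K′ = proj₁ (cone-replace G K i)
  K′-view = proj₂ (cone-replace G K i)
  large : ∀ j → vert K′ j ≡ zero ⊎ (j ≢ i × vert K′ j ≡ suc (vert K j)) → r < c (vert K′ j)
  large j (inj₁ ≡0) = subst (λ v → r < c v) (≡-sym ≡0) (ℕ.≮⇒≥ c0≮)
  large j (inj₂ (j≢i , ≡suc)) = subst (λ v → r < c v) (≡-sym ≡suc)
    (ℕ.≤∧≢⇒< (r≤c j) λ r≡c → others≢r (j , j≢i , ≡-sym r≡c))
cone-forces {n} G r p forces c | yes c0≤r with any? (λ v → c (suc v) ℕ.≟ c zero)
... | yes (v , same) = inj₁ (zero , suc v , refl , ≡-sym same , c0≤r)
... | no unused = lift (forces c′)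
  where
  -- The colour of the apex is unused in G, so it can take over the vertices of colour r.
  recolour : ∀ x → Dec (x ≡ r) → ℕ
  recolour x (yes _) = c zero
  recolour x (no _)  = x
  c′ : Fin n → ℕ
  c′ v = recolour (c (suc v)) (c (suc v) ℕ.≟ r)
  recolour-injective : ∀ x y dx dy → x ≢ c zero → y ≢ c zero → recolour x dx ≡ recolour y dy → x ≡ y
  recolour-injective x y (yes x≡r) (yes y≡r) _  _  _  = trans x≡r (≡-sym y≡r)
  recolour-injective x y (yes _)   (no _)    _  y≢ eq = contradiction (≡-sym eq) y≢
  recolour-injective x y (no _)    (yes _)   x≢ _  eq = contradiction eq x≢
  recolour-injective x y (no _)    (no _)    _  _  eq = eq
  small : ∀ x dx → recolour x dx < r → x < suc r
  small x (yes x≡r) _   = s≤s (ℕ.≤-reflexive x≡r)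
  small x (no _)    x<r = ℕ.m<n⇒m<1+n x<r
  large : ∀ x dx → x ≢ c zero → r ≤ recolour x dx → r < x
  large x (yes x≡r) x≢ r≤c0 = contradiction (trans x≡r (ℕ.≤-antisym r≤c0 (ℕ.≤-pred c0≤r))) x≢
  large x (no x≢r)  _  r≤x  = ℕ.≤∧≢⇒< r≤x (x≢r ∘ ≡-sym)
  lift : Forced G r p c′ → Forced (cone G) (suc r) p c
  lift (inj₁ (u , v , uv , same , c′u<r)) = inj₁ (suc u , suc v , uv ,
    recolour-injective _ _ (c (suc u) ℕ.≟ r) (c (suc v) ℕ.≟ r)
      (λ eq → unused (u , eq)) (λ eq → unused (v , eq)) same ,
    small _ (c (suc u) ℕ.≟ r) c′u<r)
  lift (inj₂ (K , r≤c′)) = inj₂ (cone-clique G K , λ j →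
    large _ (c (suc (vert K j)) ℕ.≟ r) (λ eq → unused (vert K j , eq)) (r≤c′ j))

-- Lower bounds for the order

-- Give colour 0 to `v` alone: a single vertex spans no edge.
forces⇒CliqueAvoiding : ∀ {n} (G : Graph n) {a} → Forces G 1 a → ∀ v → CliqueAvoiding G a v
forces⇒CliqueAvoiding {n} G {a} forces v = from (forces λ u → colour (u ≟ v))
  where
  colour : ∀ {u} → Dec (u ≡ v) → ℕ
  colour (yes _) = 0
  colour (no _)  = 1
  colour<1 : ∀ {u} (d : Dec (u ≡ v)) → colour d < 1 → u ≡ v
  colour<1 (yes u≡v) _ = u≡v
  colour<1 (no _) (s≤s ())
  1≤colour : ∀ {u} (d : Dec (u ≡ v)) → 1 ≤ colour d → u ≢ v
  1≤colour (no u≢v) _ = u≢v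
  from : Forced G 1 a (λ u → colour (u ≟ v)) → CliqueAvoiding G a v
  from (inj₁ (u , w , uw , same , cu<1))
    with colour<1 (u ≟ v) cu<1 | colour<1 (w ≟ v) (subst (_< 1) same cu<1)
  ... | refl | refl = contradiction (irrefl G v) (true≢false uw)
  from (inj₂ (K , 1≤c)) = K , λ i → 1≤colour (vert K i ≟ v) (1≤c i)

forces⇒Clique : ∀ {n} (G : Graph n) r {p} → Forces G r p → Clique G p
forces⇒Clique G r forces with forces (λ _ → r)
... | inj₁ (_ , _ , _ , _ , r<r) = contradiction r<r (ℕ.<-irrefl refl)
... | inj₂ (K , _) = K

-- `Forces G 1 a` supplies both the maximum clique and the cliques avoiding each vertex. So at most
-- `n - a` colours suffice, while more than `r + p` are required.
forces⇒<order : ∀ {n a} (G : Graph n) r p → CliqueNumber< G (suc a) → Forces G 1 a →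
  Forces G r (suc p) → r + p + a < n
forces⇒<order {a = a} G r p ω≤a forces₁ forces =
  let k , k+a≤n , colouring =
        colouring-≤ G ω≤a (forces⇒Clique G 1 forces₁) (forces⇒CliqueAvoiding G forces₁) in
  ℕ.≤-trans (ℕ.+-monoˡ-≤ a (forces⇒<colours G r p k forces colouring)) k+a≤n

shrink-clique : ∀ {n a b} (G : Graph n) → b ≤ a → Clique G a → Clique G b
shrink-clique G b≤a K = mkClique G (λ i → vert K (inject≤ i b≤a))
  λ i j i≢j → edge K _ _ (i≢j ∘ inject≤-injective b≤a b≤a i j)

-- Giving all vertices different colours shows that `n` exceeds `2 + p`, so a complete graph would
-- contain too large a clique.
forces₂⇒nonedge : ∀ {n} (G : Graph n) p → CliqueNumber< G (suc (suc p)) → Forces G 2 (suc p) →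
  ∃₂ λ u v → u ≢ v × adj G u v ≡ false
forces₂⇒nonedge {n} G p ω≤p forces
  with any? (λ u → any? λ v → ¬? (u ≟ v) ×-dec (adj G u v ≟ᵇ false))
... | yes (u , v , nonedge) = u , v , nonedge
... | no complete = contradiction
  (shrink-clique G (ℕ.<⇒≤ (forces⇒<colours G 2 p n forces ((λ v → v) , λ { u _ refl → irrefl G u })))
    (mkClique G (λ v → v) λ u v u≢v → ≢false⇒≡true λ nonadj → complete (u , v , u≢v , nonadj)))
  ω≤p

-- Deleting two non-adjacent vertices uses up one of the twos. What is left forces `(2, suc p)`,
-- which serves both as the arrowing and as the source of avoiding cliques in `forces⇒<order`.
forces₂⇒<order : ∀ {n} (G : Graph n) p → CliqueNumber< G (suc (suc p)) → Forces G 2 (suc p) →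
  2 + (suc p + suc p) < n
forces₂⇒<order {n} G p ω≤p forces with forces₂⇒nonedge G p ω≤p forces
... | u , v , u≢v , nonadj = ℕ.≤-trans (s≤s (s≤s rest-order))
  (injective⇒≤ (copair-injective uv (elem E) uv-injective (injective E) uv-outside))
  where
  E : Enumeration (λ w → w ≢ u × w ≢ v)
  E = enumerate λ w → ¬? (w ≟ u) ×-dec ¬? (w ≟ v)
  uv : Fin 2 → Fin n
  uv zero       = u
  uv (suc zero) = v
  uv-injective : Injective _≡_ _≡_ uv
  uv-injective {zero}     {zero}     _  = refl
  uv-injective {zero}     {suc zero} eq = contradiction eq u≢v
  uv-injective {suc zero} {zero}     eq = contradiction (≡-sym eq) u≢v
  uv-injective {suc zero} {suc zero} _  = refl
  uv-outside : ∀ i j → uv i ≢ elem E j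
  uv-outside zero       j eq = proj₁ (sound E j) (≡-sym eq)
  uv-outside (suc zero) j eq = proj₂ (sound E j) (≡-sym eq)
  deleted : ∀ w → ¬ (w ≢ u × w ≢ v) → w ≡ u ⊎ w ≡ v
  deleted w ∉E with w ≟ u | w ≟ v
  ... | yes w≡u | _       = inj₁ w≡u
  ... | no _    | yes w≡v = inj₂ w≡v
  ... | no w≢u  | no w≢v  = contradiction (w≢u , w≢v) ∉E
  independent : ∀ x y → ¬ (x ≢ u × x ≢ v) → ¬ (y ≢ u × y ≢ v) → adj G x y ≡ false
  independent x y ∉E ∉E′ with deleted x ∉E | deleted y ∉E′
  ... | inj₁ refl | inj₁ refl = irrefl G u
  ... | inj₁ refl | inj₂ refl = nonadj
  ... | inj₂ refl | inj₁ refl = trans (Graph.sym G v u) nonadj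
  ... | inj₂ refl | inj₂ refl = irrefl G v
  H = pullback G (elem E)
  rest-forces : Forces H 1 (suc p)
  rest-forces = delete-independent G (λ w → ¬? (w ≟ u) ×-dec ¬? (w ≟ v)) E independent forces
  rest-order : 1 + (suc p + suc p) ≤ size E
  rest-order = forces⇒<order H 1 p (ω≤p ∘ pullback-clique G (elem E)) rest-forces rest-forces

-- Minimal graphs

≢true⇒≡false : ∀ {b} → b ≢ true → b ≡ false
≢true⇒≡false {false} _       = refl
≢true⇒≡false {true}  b≢true = contradiction refl b≢true

module _ {n : ℕ} (G : Graph n) (r p q : ℕ) (forces : Forces G (suc r) (suc p))
         (minimal : ∀ m (H : Graph m) → Forces H r (suc p) → CliqueNumber< H q → n ≤ m) where

  -- Deleting a non-empty independent set leaves a smaller graph that forces `(2_r, suc p)`; by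
  -- minimality it must contain a `q`-clique.
  minimal⇒clique : {P : Fin n → Set} → (∀ u → Dec (P u)) → ∃ (λ v → ¬ P v) →
    (∀ x y → ¬ P x → ¬ P y → adj G x y ≡ false) → Σ (Clique G q) λ K → ∀ j → P (vert K j)
  minimal⇒clique {P} P? (v , ¬Pv) independent with clique? G q P?
  ... | yes found = found
  ... | no none = contradiction
    (minimal (size E) (pullback G (elem E)) (delete-independent G P? E independent forces)
      λ K → none (pullback-clique G (elem E) K , λ j → sound E (vert K j)))
    (ℕ.<⇒≱ (injective⇒≤ (copair-injective {1} (λ _ → v) (elem E) (λ { {zero} {zero} _ → refl }) (injective E)
      λ _ j v≡ → ¬Pv (subst P (≡-sym v≡) (sound E j)))))
    where
    E : Enumeration P
    E = enumerate P?

  -- Without an edge in colour 0 this class is independent, and deleting it leaves a `q`-clique in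
  -- the other colours.
  minimal⇒forces₁ : Forces G 1 q
  minimal⇒forces₁ c
    with any? (λ u → any? λ v → (adj G u v ≟ᵇ true) ×-dec (c u ℕ.≟ c v) ×-dec (c u ℕ.<? 1))
  ... | yes (u , v , mono) = inj₁ (u , v , mono)
  ... | no ¬mono with any? (λ v → ¬? (1 ℕ.≤? c v))
  ...   | yes uncoloured = inj₂ (minimal⇒clique (λ u → 1 ℕ.≤? c u) uncoloured λ x y x≱1 y≱1 →
    let x<1 = ℕ.≰⇒> x≱1 ; y<1 = ℕ.≰⇒> y≱1 in ≢true⇒≡false λ xy →
    ¬mono (x , y , xy , trans (ℕ.n<1⇒n≡0 x<1) (≡-sym (ℕ.n<1⇒n≡0 y<1)) , x<1))
  -- Colour 0 does not occur, so a single vertex is deleted instead; the forced clique shows that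
  -- there is one.
  ...   | no ¬<1 = inj₂ (proj₁ (minimal⇒clique (λ u → ¬? (u ≟ v)) (v , λ v≢v → v≢v refl) v-independent) ,
    λ j → decidable-stable (1 ℕ.≤? c _) λ <1 → ¬<1 (_ , <1))
    where
    v = vert (forces⇒Clique G (suc r) forces) zero
    v-independent : ∀ x y → ¬ x ≢ v → ¬ y ≢ v → adj G x y ≡ false
    v-independent x y ¬x≢v ¬y≢v with decidable-stable (x ≟ v) ¬x≢v | decidable-stable (y ≟ v) ¬y≢v
    ... | refl | refl = irrefl G x

-- A 16-vertex graph for (2,2,5)

all-or : ∀ {X : Set} {a} {P : Fin a → Set} → (∀ i → X ⊎ P i) → X ⊎ (∀ i → P i)
all-or {a = zero}  h = inj₂ λ ()
all-or {a = suc a} h with h zero | all-or (h ∘ suc)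
... | inj₁ x | _      = inj₁ x
... | inj₂ _ | inj₁ x = inj₁ x
... | inj₂ p0 | inj₂ ps = inj₂ λ { zero → p0 ; (suc i) → ps i }

hasClique : ∀ {n} → Graph n → ℕ → List (Fin n) → Bool
hasClique G zero    vs = true
hasClique G (suc a) vs = any (λ v → hasClique G a (filter (T? ∘ adj G v) vs)) vs

clique⇒hasClique : ∀ {n} (G : Graph n) {a} (K : Fin a → Fin n) → (∀ i j → i ≢ j → adj G (K i) (K j) ≡ true) →
  ∀ vs → (∀ i → K i ∈ vs) → T (hasClique G a vs)
clique⇒hasClique G {zero}  K K-edge vs K∈vs = _
clique⇒hasClique G {suc a} K K-edge vs K∈vs = any⁺ _ (Any.map (λ { refl →
  clique⇒hasClique G (K ∘ suc) (λ i j i≢j → K-edge (suc i) (suc j) (i≢j ∘ sucᶠ-injective)) _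
    λ i → ∈-filter⁺ (T? ∘ adj G (K zero)) (K∈vs (suc i)) (Equivalence.from T-≡ (K-edge zero (suc i) λ ())) })
  (K∈vs zero))

-- Some vertex of a clique that avoids the vertices As of colour 0 and Bs of colour 1 has colour
-- 0 or 1 itself, unless the clique has colours ≥ 2 only; so branch over the choice.
module Search {n p : ℕ} (G : Graph n) (cliques : List (Clique G p)) where

  joined : Fin n → List (Fin n) → Bool
  joined v = any (adj G v)

  fresh : Fin n → List (Fin n) → Bool
  fresh v vs = not (any (λ u → does (v ≟ u)) vs)

  refute : ℕ → List (Fin n) → List (Fin n) → Bool
  branch : ℕ → List (Fin n) → List (Fin n) → Fin n → Bool

  refute zero       As Bs = false
  refute (suc fuel) As Bs = any (λ K →
    all (λ i → fresh (vert K i) (As ++ Bs)) (allFin p) ∧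
    all (λ i → branch fuel As Bs (vert K i)) (allFin p)) cliques

  branch fuel As Bs v = (joined v As ∨ refute fuel (v ∷ As) Bs) ∧ (joined v Bs ∨ refute fuel As (v ∷ Bs))

  module _ (c : Fin n → ℕ) where

    joined⇒forced : ∀ {x} v vs → x < 2 → c v ≡ x → All (λ u → c u ≡ x) vs → T (joined v vs) → Forced G 2 p c
    joined⇒forced v (u ∷ vs) x<2 cv≡x (cu≡x ∷ cvs≡x) j with Equivalence.to T-∨ j
    ... | inj₁ vu = inj₁ (v , u , Equivalence.to T-≡ vu , trans cv≡x (≡-sym cu≡x) ,
      subst (_< 2) (≡-sym cv≡x) x<2)
    ... | inj₂ j′ = joined⇒forced v vs x<2 cv≡x cvs≡x j′

    -- If no branch yields `Forced`, every vertex of the chosen clique has colour at least 2, and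
    -- the clique itself is the outcome.
    refute-sound : ∀ fuel As Bs → All (λ v → c v ≡ 0) As → All (λ v → c v ≡ 1) Bs →
      T (refute fuel As Bs) → Forced G 2 p c
    branch-sound : ∀ fuel As Bs → All (λ v → c v ≡ 0) As → All (λ v → c v ≡ 1) Bs →
      ∀ v → T (branch fuel As Bs v) → Forced G 2 p c ⊎ 2 ≤ c v

    refute-sound (suc fuel) As Bs cA cB r =
      let K , K-ok = Any.satisfied (any⁻ _ cliques r)
          K-branch = all⁺ _ (allFin p) (proj₂ (Equivalence.to T-∧ K-ok))
      in [ (λ forced → forced) , (λ 2≤c → inj₂ (K , 2≤c)) ]′
           (all-or λ i → branch-sound fuel As Bs cA cB (vert K i) (All.lookup K-branch (∈-allFin i)))

    branch-sound fuel As Bs cA cB v b with c v in cv | Equivalence.to T-∧ b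
    ... | suc (suc _) | _ = inj₂ (s≤s (s≤s z≤n))
    ... | 0 | b₀ , _ with Equivalence.to T-∨ b₀
    ...   | inj₁ j = inj₁ (joined⇒forced v As (s≤s z≤n) cv cA j)
    ...   | inj₂ r = inj₁ (refute-sound fuel (v ∷ As) Bs (cv ∷ cA) cB r)
    branch-sound fuel As Bs cA cB v b | 1 | _ , b₁ with Equivalence.to T-∨ b₁
    ...   | inj₁ j = inj₁ (joined⇒forced v Bs (s≤s (s≤s z≤n)) cv cB j)
    ...   | inj₂ r = inj₁ (refute-sound fuel As (v ∷ Bs) cA (cv ∷ cB) r)

-- The complement of G₁₆ is the 4-regular triangle-free Cayley graph of the semidihedral group of
-- order 16: an 8-cycle i ~ i ± 1 and an 8-cycle i ~ i ± 3, each with its four long diagonals,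
-- joined by the perfect matching of equal residues.
G₁₆ : Graph 16
G₁₆ = record
  { adj    = adj₁₆
  ; sym    = from-yes (all? λ u → all? λ v → adj₁₆ u v ≟ᵇ adj₁₆ v u)
  ; irrefl = from-yes (all? λ v → adj₁₆ v v ≟ᵇ false)
  }
  where
  chord : Fin 2 → ℕ → Bool
  chord zero       d = any (d ≡ᵇ_) (2 ∷ 3 ∷ 5 ∷ 6 ∷ [])
  chord (suc zero) d = any (d ≡ᵇ_) (1 ∷ 2 ∷ 6 ∷ 7 ∷ [])
  distance : Fin 8 → Fin 8 → ℕ
  distance x y = (toℕ x + (8 ∸ toℕ y)) % 8
  adj-at : Fin 2 × Fin 8 → Fin 2 × Fin 8 → Bool
  adj-at (zero     , x) (zero     , y) = chord zero (distance x y)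
  adj-at (suc zero , x) (suc zero , y) = chord (suc zero) (distance x y)
  adj-at (_        , x) (_        , y) = not (does (x ≟ y))
  adj₁₆ : Fin 16 → Fin 16 → Bool
  adj₁₆ u v = adj-at (remQuot {2} 8 u) (remQuot {2} 8 v)

-- Four cliques and their images under adding `t` to all residues, which preserves adjacency.
cliques₁₆ : List (Clique G₁₆ 5)
cliques₁₆ = All.reduce (λ {xs} → mkClique G₁₆ (Vec.lookup xs)) all-cliques
  where
  outer inner : ℕ → Fin 16
  outer x = combine {2} zero (x mod 8)
  inner x = combine {2} (suc zero) (x mod 8)
  rotations : ℕ → List (Vec (Fin 16) 5)
  rotations t =
    (outer t ∷ outer (2 + t) ∷ outer (5 + t) ∷ inner (1 + t) ∷ inner (3 + t) ∷ []) ∷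
    (outer t ∷ outer (2 + t) ∷ outer (5 + t) ∷ inner (6 + t) ∷ inner (7 + t) ∷ []) ∷
    (outer t ∷ outer (2 + t) ∷ inner (4 + t) ∷ inner (5 + t) ∷ inner (6 + t) ∷ []) ∷
    (outer t ∷ outer (3 + t) ∷ inner (5 + t) ∷ inner (6 + t) ∷ inner (7 + t) ∷ []) ∷ []
  all-cliques : All (λ xs → ∀ i j → i ≢ j → adj G₁₆ (Vec.lookup xs i) (Vec.lookup xs j) ≡ true)
                    (concatMap rotations (upTo 8))
  all-cliques = from-yes (All.all? (λ xs → all? λ i → all? λ j →
    ¬? (i ≟ j) →-dec (adj G₁₆ (Vec.lookup xs i) (Vec.lookup xs j) ≟ᵇ true)) (concatMap rotations (upTo 8)))

G₁₆-forces : Forces G₁₆ 2 5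
-- Five nested clique choices close every branch; the last argument is the unit value, since
-- `refute` evaluates to `true`.
G₁₆-forces c = Search.refute-sound G₁₆ cliques₁₆ c 5 [] [] [] [] _

G₁₆-CliqueNumber< : CliqueNumber< G₁₆ 6
-- `hasClique` evaluates to `false` here, so this term has the empty type.
G₁₆-CliqueNumber< K = clique⇒hasClique G₁₆ (vert K) (edge K) (allFin 16) (∈-allFin ∘ vert K)

-- The numbers F_v(2_r,p;r+p-1)

module _ {p : ℕ} (f : ℕ → ℕ) (f-min : ∀ r → 2 ≤ r → IsFv (twosThen r p) (r + p ∸ 1) (f r)) where

  f-suc-≤ : ∀ r → 2 ≤ r → f (suc r) ≤ suc (f r)
  -- Matching on `suc r′` lets `r + p ∸ 1` reduce, so that the clique bound of the cone has the
  -- required form.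
  f-suc-≤ r@(suc r′) 2≤r with proj₁ (f-min r 2≤r)
  ... | G , arrows , ω<q = proj₂ (f-min (suc r) (ℕ.m≤n⇒m≤1+n 2≤r)) (suc (f r)) (cone G)
    (forces⇒arrows (cone G) (suc r) p (cone-forces G r p (arrows⇒forces G r p arrows)))
    (cone-CliqueNumber< G (r + p ∸ 1) ω<q)

  f-+-≤ : ∀ r → 2 ≤ r → ∀ d → f (d + r) ≤ d + f r
  f-+-≤ r 2≤r zero    = ℕ.≤-refl
  f-+-≤ r 2≤r (suc d) = ℕ.≤-trans (f-suc-≤ (d + r) (ℕ.m≤n⇒m≤o+n d 2≤r)) (s≤s (f-+-≤ r 2≤r d))

  f-min-forces : ∀ r → 2 ≤ r → ∀ n (G : Graph n) → Forces G r p → CliqueNumber< G (r + p ∸ 1) → f r ≤ n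
  f-min-forces r 2≤r n G forces = proj₂ (f-min r 2≤r) n G (forces⇒arrows G r p forces)

-- `f r` stands for F_v(2_r,p;r+p-1). Differences `f r - r` are compared by adding across, which
-- avoids truncated subtraction.
theorem9 : (p : ℕ) → 2 ≤ p →
    (f : ℕ → ℕ) → (∀ r → 2 ≤ r → IsFv (twosThen r p) (r + p ∸ 1) (f r)) →
    (r0 : ℕ) → 2 ≤ r0 →
    (∀ r → 2 ≤ r → f r0 + r ≤ f r + r0) →
    (∀ r → 2 ≤ r → r < r0 → f r0 + r < f r + r0) →
    ((∀ r → r0 ≤ r → f r + r0 ≡ f r0 + r)
    × (r0 ≡ 2 → ∀ r → 2 ≤ r → f r + 2 ≡ f 2 + r)
    × (2 < r0 → (G : Graph (f r0)) → Arrows G (twosThen r0 p) →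
        CliqueNumber< G (r0 + p ∸ 1) → Arrows G (2 List.∷ (r0 + p ∸ 2) List.∷ List.[]))
    × (r0 + 2 * p < f 2)
    × (p ≡ 5 → r0 ≤ 5))
theorem9 p@(suc (suc p′)) 2≤p@(s≤s (s≤s _)) f f-min r0 2≤r0 least first =
  linear , (λ { refl → linear }) ,
  (λ 2<r0 G arrows _ → forces⇒arrows G 1 (r0 + p ∸ 2)
    (forces₁ r0 2<r0 first G (arrows⇒forces G r0 p arrows))) ,
  bound r0 2≤r0 first , r0≤5
  where
  linear : ∀ r → r0 ≤ r → f r + r0 ≡ f r0 + r
  linear r r0≤r = ℕ.≤-antisym upper (least r (ℕ.≤-trans 2≤r0 r0≤r))
    where
    d = r ∸ r0
    open ℕ.≤-Reasoning
    upper : f r + r0 ≤ f r0 + r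
    upper = begin
      f r + r0           ≡⟨ cong (λ s → f s + r0) (ℕ.m∸n+n≡m r0≤r) ⟨
      f (d + r0) + r0    ≤⟨ ℕ.+-monoˡ-≤ r0 (f-+-≤ f f-min r0 2≤r0 d) ⟩
      (d + f r0) + r0    ≡⟨ rearrange d (f r0) r0 ⟩
      f r0 + (d + r0)    ≡⟨ cong (f r0 +_) (ℕ.m∸n+n≡m r0≤r) ⟩
      f r0 + r           ∎
      where
      rearrange : ∀ d x y → (d + x) + y ≡ x + (d + y)
      rearrange = solve-∀
  forces₁ : ∀ r0 → 2 < r0 →
    (∀ r → 2 ≤ r → r < r0 → f r0 + r < f r + r0) →
    (G : Graph (f r0)) → Forces G r0 p → Forces G 1 (r0 + p ∸ 2)
  forces₁ (suc zero)       (s≤s ())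
  forces₁ (suc (suc zero)) (s≤s (s≤s ()))
  forces₁ (suc r@(suc (suc _))) _ first G forces =
    -- With `r = r0 - 1`, the size `r0 + p - 2` is the clique bound `r + p - 1` belonging to `f r`.
    minimal⇒forces₁ G r (suc p′) (suc r + p ∸ 2) forces λ m H H-forces H-ω →
      ℕ.≤-trans f-mono (f-min-forces f f-min r 2≤r m H H-forces H-ω)
    where
    2≤r : 2 ≤ r
    2≤r = s≤s (s≤s z≤n)
    f-mono : f (suc r) ≤ f r
    -- The strict inequality `first` at `r0 - 1` makes up for the difference of one.
    f-mono = ℕ.+-cancelʳ-≤ r _ _ (ℕ.≤-pred
      (subst (f (suc r) + r <_) (ℕ.+-suc (f r) r) (first r 2≤r ℕ.≤-refl)))
  bound : ∀ r0 → 2 ≤ r0 → (∀ r → 2 ≤ r → r < r0 → f r0 + r < f r + r0) → r0 + 2 * p < f 2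
  bound (suc zero) (s≤s ()) _
  bound 2 _ _ = let G , arrows , ω<q = proj₁ (f-min 2 ℕ.≤-refl) in
    subst (_< f 2) (cong (λ x → 2 + (p + x)) (≡-sym (ℕ.+-identityʳ p)))
      (forces₂⇒<order G (suc p′) ω<q (arrows⇒forces G 2 p arrows))
  bound r0@(suc (suc (suc r))) 2≤r0 first =
    let G , arrows , ω<q = proj₁ (f-min r0 2≤r0)
        forces = arrows⇒forces G r0 p arrows
        -- With `a = r0 + p - 2` this says 2 r0 + 2 p - 3 < `f r0`; `first` at 2 then carries the
        -- bound over to `f 2`.
        order = forces⇒<order G r0 (suc p′) ω<q (forces₁ r0 (s≤s (s≤s (s≤s z≤n))) first G forces) forces
    in ℕ.+-cancelʳ-≤ r0 _ _ (begin
      suc (r0 + 2 * p) + r0                   ≡⟨ rearrange r p′ ⟩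
      suc (suc (r0 + suc p′ + suc (r + p)) + 2) ≤⟨ s≤s (ℕ.+-monoˡ-≤ 2 order) ⟩
      suc (f r0 + 2)                          ≤⟨ first 2 ℕ.≤-refl (s≤s (s≤s (s≤s z≤n))) ⟩
      f 2 + r0                                ∎)
    where
    open ℕ.≤-Reasoning
    rearrange : ∀ r p′ → suc (3 + r + 2 * (2 + p′)) + (3 + r) ≡
      suc (suc (3 + r + suc p′ + suc (r + (2 + p′))) + 2)
    rearrange = solve-∀
  r0≤5 : p ≡ 5 → r0 ≤ 5
  -- The bound reads `r0 + 10 < f 2`, and `G₁₆` gives `f 2 ≤ 16`.
  r0≤5 refl = ℕ.+-cancelʳ-≤ 10 r0 5 (ℕ.≤-pred (ℕ.≤-trans (bound r0 2≤r0 first)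
    (f-min-forces f f-min 2 ℕ.≤-refl 16 G₁₆ G₁₆-forces G₁₆-CliqueNumber<)))
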